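{- A class $\mathcal C$ of split graphs is $\mathrm{MSO}_2$-orderable if, and only if, there is some $s\in\mathbb N$ such that $\mathcal C$ has property $\mathsf{SEP}(f)$ for the function $f$ with $f(n)=2^{s(n+1)}$.
   Context: A (finite, simple, undirected) graph is a split graph if its vertex set can be partitioned into two parts $A$ and $B$ such that $A$ induces a clique and $B$ is independent. For a graph $G=\langle V,E\rangle$, $\lceil G\rceil=\langle V\cup E,\mathrm{inc}\rangle$ is the structure with universe $V\cup E$ and the vertex–edge incidence relation. A class of graphs is $\mathrm{MSO}_2$-orderable if there is an MSO-formula $\varphi(x,y;\bar Z)$ ($\bar Z$ set variables) such that for every nonempty $G$ in the class there are sets $\bar P\subseteq V\cup E$ for which $\{(a,b):\lceil G\rceil\models\varphi(a,b;\bar P)\}$ is a linear order on $V\cup E$. $\mathrm{Sep}(G,k)$ is the maximal number of connected components of $G-S$ over vertex sets $S$ with $|S|\le k$; a class has property $\mathsf{SEP}(f)$ if $\mathrm{Sep}(G,k)\le f(k)$ for all its members $G$ and all $k\in\mathbb N$. -}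

module Defs where

open import Data.Nat using (ℕ; zero; suc; _+_; _*_; _^_; _≤_)
open import Data.Fin using (Fin)
open import Data.Fin.Subset using (Subset; _∈_; _∉_; ∣_∣)
open import Data.Bool using (Bool; true)
open import Data.Product using (Σ; ∃; _×_; _,_; proj₁; proj₂)
open import Data.Sum using (_⊎_; inj₁; inj₂)
open import Data.Empty using (⊥)
open import Relation.Nullary using (¬_)
open import Relation.Binary.PropositionalEquality using (_≡_; _≢_)
open import Relation.Binary.Structures using (IsTotalOrder)

record Graph : Set where
  field
    n       : ℕ
    m       : ℕ
    ends    : Fin m → Fin n × Fin n
    noLoop  : ∀ e → proj₁ (ends e) ≢ proj₂ (ends e)
    noMulti : ∀ e e' →
              (ends e ≡ ends e' ⊎ ends e ≡ (proj₂ (ends e') , proj₁ (ends e'))) →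
              e ≡ e'
open Graph public

Adj : (G : Graph) → Fin (n G) → Fin (n G) → Set
Adj G u v = Σ (Fin (m G)) λ e → (ends G e ≡ (u , v)) ⊎ (ends G e ≡ (v , u))

IsSplit : Graph → Set
IsSplit G = Σ (Subset (n G)) λ A →
  (∀ u v → u ∈ A → v ∈ A → u ≢ v → Adj G u v) ×
  (∀ u v → u ∉ A → v ∉ A → ¬ Adj G u v)

U : Graph → Set
U G = Fin (n G) ⊎ Fin (m G)

Inc : (G : Graph) → U G → U G → Set
Inc G (inj₁ v) (inj₂ e) = (proj₁ (ends G e) ≡ v) ⊎ (proj₂ (ends G e) ≡ v)
Inc G _ _ = ⊥

-- MSO formulas over the signature {inc} with k free element variables
-- and l free set variables (de Bruijn indices).

data Formula : ℕ → ℕ → Set where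
  eq   : ∀ {k l} → Fin k → Fin k → Formula k l
  inc  : ∀ {k l} → Fin k → Fin k → Formula k l
  mem  : ∀ {k l} → Fin k → Fin l → Formula k l
  neg  : ∀ {k l} → Formula k l → Formula k l
  and  : ∀ {k l} → Formula k l → Formula k l → Formula k l
  or   : ∀ {k l} → Formula k l → Formula k l → Formula k l
  ex₁  : ∀ {k l} → Formula (suc k) l → Formula k l
  ex₂  : ∀ {k l} → Formula k (suc l) → Formula k l
  all₁ : ∀ {k l} → Formula (suc k) l → Formula k l
  all₂ : ∀ {k l} → Formula k (suc l) → Formula k l

_▸_ : ∀ {A : Set} {k} → (Fin k → A) → A → Fin (suc k) → A
(ρ ▸ a) Fin.zero    = a
(ρ ▸ a) (Fin.suc i) = ρ i

USet : Graph → Set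
USet G = U G → Bool

Sat : (G : Graph) {k l : ℕ} → Formula k l →
      (Fin k → U G) → (Fin l → USet G) → Set
Sat G (eq i j)   ρ σ = ρ i ≡ ρ j
Sat G (inc i j)  ρ σ = Inc G (ρ i) (ρ j)
Sat G (mem i z)  ρ σ = σ z (ρ i) ≡ true
Sat G (neg φ)    ρ σ = ¬ Sat G φ ρ σ
Sat G (and φ ψ)  ρ σ = Sat G φ ρ σ × Sat G ψ ρ σ
Sat G (or φ ψ)   ρ σ = Sat G φ ρ σ ⊎ Sat G ψ ρ σ
Sat G (ex₁ φ)    ρ σ = Σ (U G) λ a → Sat G φ (ρ ▸ a) σ
Sat G (ex₂ φ)    ρ σ = Σ (USet G) λ P → Sat G φ ρ (σ ▸ P)
Sat G (all₁ φ)   ρ σ = (a : U G) → Sat G φ (ρ ▸ a) σ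
Sat G (all₂ φ)   ρ σ = (P : USet G) → Sat G φ ρ (σ ▸ P)

pair : ∀ {A : Set} → A → A → Fin 2 → A
pair a b Fin.zero     = a
pair a b (Fin.suc _)  = b

MSO2Orderable : (Graph → Set) → Set
MSO2Orderable C =
  Σ ℕ λ l → Σ (Formula 2 l) λ φ →
    ∀ G → C G → U G →            -- G in the class and nonempty (V ∪ E ≠ ∅)
    Σ (Fin l → USet G) λ P →
      IsTotalOrder _≡_ (λ a b → Sat G φ (pair a b) P)

data Reach (G : Graph) (S : Subset (n G)) : Fin (n G) → Fin (n G) → Set where
  here : ∀ {u} → u ∉ S → Reach G S u u
  step : ∀ {u w v} → u ∉ S → Adj G u w → Reach G S w v → Reach G S u v

-- G - S has at most c connected components: there are no c+1 vertices of
-- G - S lying in pairwise distinct components (i.e. no injection of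
-- Fin (c+1) into the set of components).
ComponentsAtMost : (G : Graph) → Subset (n G) → ℕ → Set
ComponentsAtMost G S c =
  (r : Fin (suc c) → Fin (n G)) →
  (∀ i → r i ∉ S) →
  (∀ i j → Reach G S (r i) (r j) → i ≡ j) → ⊥

HasSEP : (ℕ → ℕ) → Graph → Set
HasSEP f G = ∀ k (S : Subset (n G)) → ∣ S ∣ ≤ k → ComponentsAtMost G S (f k)

ClassHasSEP : (ℕ → ℕ) → (Graph → Set) → Set
ClassHasSEP f C = ∀ G → C G → HasSEP f G

module Submission where

-- Orderable ⇒ SEP.  All but one component of G - S are single vertices whose
-- neighbours lie in S.  Two of them with the same parameter colours, on
-- themselves and on equal neighbourhoods in S, are exchanged by an automorphism of
-- the coloured incidence structure, so no definable relation can order them.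
-- Hence their number is bounded by the number of colourings.
--
-- SEP ⇒ orderable.  At most 2 ^ (s * (|N| + 1)) independent vertices share the
-- neighbourhood N, so s edge sets and s vertex sets tell them apart.
-- The clique is ordered by a set of its edges forming a threshold graph, the
-- independent vertices lexicographically by the colours of their links to the
-- clique, and the edges lexicographically by their endpoints.

open import Defs
open import Data.Bool using (Bool; true; false; if_then_else_)
import Data.Bool.Properties as Bool
open import Data.Empty using (⊥; ⊥-elim)
open import Data.Fin
  using (Fin; zero; suc; toℕ; opposite; inject≤; splitAt; join; combine; remQuot; funToFin; finToFun)
import Data.Fin as Fin
open import Data.Fin.Induction using (spo-wellFounded)
open import Data.Fin.Properties
  using (_≟_; any?; all?; pigeonhole; 2↔Bool; remQuot-combine; combine-remQuot;
         funToFin-finToFin; finToFun-funToFin; suc-injective; <⇒≢; toℕ<n; toℕ-injective;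
         opposite-prop; inject≤-injective; splitAt-join)
open import Data.Fin.Subset using (Subset; inside; outside; _∈_; _∉_; ∣_∣)
open import Data.Fin.Subset.Properties using (_∈?_)
open import Data.Nat using (ℕ; suc; _+_; _*_; _^_; _≤_; _<_; _≤?_; s≤s)
import Data.Nat.Properties as ℕ
open import Data.Product using (Σ; ∃-syntax; _×_; _,_; proj₁; proj₂; uncurry; swap)
open import Data.Product.Function.NonDependent.Propositional using (_×-⇔_)
open import Data.Product.Properties using (≡-dec)
open import Data.Sum using (_⊎_; inj₁; inj₂; [_,_]; [_,_]′)
open import Data.Sum.Properties using (inj₁-injective)
open import Data.Vec using ([]; _∷_; here; there; tabulate)
open import Data.Vec.Properties using (lookup∘tabulate; []=⇒lookup; lookup⇒[]=; tabulate-cong)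
import Data.Vec.Properties as Vec
open import Function using (_∘_; case_of_)
open import Function.Bundles using (_⇔_; mk⇔; Equivalence; Inverse)
open import Function.Construct.Identity using (⇔-id)
open import Induction.WellFounded using (WellFounded; Acc; acc; module Subrelation)
import Relation.Binary.Construct.On as On
open import Relation.Binary.PropositionalEquality
  using (_≡_; _≢_; refl; sym; trans; cong; cong₂; subst; subst₂; isEquivalence; module ≡-Reasoning)
open import Relation.Binary.Structures using (IsTotalOrder; IsStrictPartialOrder)
open import Relation.Nullary
  using (¬_; Dec; yes; no; does; contradiction; ¬?; _×-dec_; _⊎-dec_; _→-dec_)
open import Relation.Nullary.Decidable using (dec-true; does-⇔; map′; decidable-stable)
open import Relation.Unary using (Decidable)
open Equivalence using (to; from)

-- Finite subsets and Boolean tables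

does⇒ : ∀ {P : Set} (P? : Dec P) → does P? ≡ true → P
does⇒ (yes p) _ = p

≡-from-true : ∀ {a b : Bool} → (a ≡ true → b ≡ true) → (b ≡ true → a ≡ true) → a ≡ b
≡-from-true {true}  {b}     f g = sym (f refl)
≡-from-true {false} {true}  f g = g refl
≡-from-true {false} {false} f g = refl

enum : ∀ {n} (p : Subset n) → Fin ∣ p ∣ → Fin n
enum (inside  ∷ p) zero    = zero
enum (inside  ∷ p) (suc i) = suc (enum p i)
enum (outside ∷ p) i       = suc (enum p i)

enum-∈ : ∀ {n} (p : Subset n) i → enum p i ∈ p
enum-∈ (inside  ∷ p) zero    = here
enum-∈ (inside  ∷ p) (suc i) = there (enum-∈ p i)
enum-∈ (outside ∷ p) i       = there (enum-∈ p i)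

enum-injective : ∀ {n} (p : Subset n) {i j} → enum p i ≡ enum p j → i ≡ j
enum-injective (inside  ∷ p) {zero}  {zero}  eqn = refl
enum-injective (inside  ∷ p) {suc i} {suc j} eqn =
  cong suc (enum-injective p (suc-injective eqn))
enum-injective (outside ∷ p) eqn = enum-injective p (suc-injective eqn)

rank : ∀ {n} (p : Subset n) {v} → v ∈ p → Fin ∣ p ∣
rank (inside  ∷ p) here        = zero
rank (inside  ∷ p) (there v∈p) = suc (rank p v∈p)
rank (outside ∷ p) (there v∈p) = rank p v∈p

enum-rank : ∀ {n} (p : Subset n) {v} (v∈p : v ∈ p) → enum p (rank p v∈p) ≡ v
enum-rank (inside  ∷ p) here        = refl
enum-rank (inside  ∷ p) (there v∈p) = cong suc (enum-rank p v∈p)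
enum-rank (outside ∷ p) (there v∈p) = cong suc (enum-rank p v∈p)

⁅_⁆? : ∀ {n} {P : Fin n → Set} → Decidable P → Subset n
⁅ P? ⁆? = tabulate (does ∘ P?)

module _ {n} {P : Fin n → Set} (P? : Decidable P) where

  comprehension⁺ : ∀ {v} → P v → v ∈ ⁅ P? ⁆?
  comprehension⁺ {v} Pv =
    lookup⇒[]= v _ (trans (lookup∘tabulate _ v) (dec-true (P? v) Pv))

  comprehension⁻ : ∀ {v} → v ∈ ⁅ P? ⁆? → P v
  comprehension⁻ {v} v∈ =
    does⇒ (P? v) (trans (sym (lookup∘tabulate _ v)) ([]=⇒lookup v∈))

funToFin-cong : ∀ {m n} {f g : Fin m → Fin n} → (∀ i → f i ≡ g i) → funToFin f ≡ funToFin g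
funToFin-cong {ℕ.zero} f≗g = refl
funToFin-cong {suc m}  f≗g = cong₂ combine (f≗g zero) (funToFin-cong (f≗g ∘ suc))

module _ {s k : ℕ} where

  open Inverse 2↔Bool using (strictlyInverseˡ; strictlyInverseʳ)
    renaming (to to toBool; from to fromBool)

  -- Tables with `s` rows and `k` columns correspond to numbers below `2 ^ (s * k)`. Injectivity of
  -- `encode` serves to count types, injectivity of `decode` to hand out distinct colourings.
  encode : (Fin s → Fin k → Bool) → Fin (2 ^ (s * k))
  encode g = funToFin (fromBool ∘ uncurry g ∘ remQuot {s} k)

  decode : Fin (2 ^ (s * k)) → Fin s → Fin k → Bool
  decode x c i = toBool (finToFun x (combine c i))

  decode-encode : ∀ g c i → decode (encode g) c i ≡ g c i
  decode-encode g c i = begin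
    toBool (finToFun (encode g) (combine c i))
      ≡⟨ cong toBool (finToFun-funToFin _ (combine c i)) ⟩
    toBool (fromBool (uncurry g (remQuot k (combine c i))))
      ≡⟨ strictlyInverseˡ _ ⟩
    uncurry g (remQuot k (combine c i))
      ≡⟨ cong (uncurry g) (remQuot-combine c i) ⟩
    g c i ∎
    where open ≡-Reasoning

  encode-injective : ∀ {g h} → encode g ≡ encode h → ∀ c i → g c i ≡ h c i
  encode-injective {g} {h} eqn c i =
    trans (sym (decode-encode g c i)) (trans (cong (λ x → decode x c i) eqn) (decode-encode h c i))

  decode-injective : ∀ {x y} → (∀ c i → decode x c i ≡ decode y c i) → x ≡ y
  decode-injective {x} {y} eqn = begin
    x                                 ≡⟨ funToFin-finToFin {s * k} {2} x ⟨
    funToFin (finToFun {2} {s * k} x) ≡⟨ funToFin-cong agree ⟩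
    funToFin (finToFun {2} {s * k} y) ≡⟨ funToFin-finToFin {s * k} {2} y ⟩
    y                                 ∎
    where
    open ≡-Reasoning
    agree : ∀ q → finToFun {2} {s * k} x q ≡ finToFun {2} {s * k} y q
    agree q = begin
      finToFun x q                     ≡⟨ strictlyInverseʳ _ ⟨
      fromBool (toBool (finToFun x q)) ≡⟨ cong fromBool same ⟩
      fromBool (toBool (finToFun y q)) ≡⟨ strictlyInverseʳ _ ⟩
      finToFun y q                     ∎
      where
      same : toBool (finToFun x q) ≡ toBool (finToFun y q)
      same = subst (λ r → toBool (finToFun x r) ≡ toBool (finToFun y r))
        (combine-remQuot {s} k q) (eqn _ _)

-- Automorphisms and twins

module Edges (G : Graph) where

  Joins : Fin (m G) → Fin (n G) → Fin (n G) → Set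
  Joins e u w = (ends G e ≡ (u , w)) ⊎ (ends G e ≡ (w , u))

  joins? : ∀ e u w → Dec (Joins e u w)
  joins? e u w = (ends G e ≟² (u , w)) ⊎-dec (ends G e ≟² (w , u))
    where _≟²_ = ≡-dec _≟_ _≟_

  adj? : ∀ u w → Dec (Adj G u w)
  adj? u w = any? λ e → joins? e u w

  joins-sym : ∀ {e u w} → Joins e u w → Joins e w u
  joins-sym = [ inj₂ , inj₁ ]′

  adj-sym : ∀ {u w} → Adj G u w → Adj G w u
  adj-sym (e , j) = e , joins-sym j

  joins-irrefl : ∀ {e u w} → Joins e u w → u ≢ w
  joins-irrefl {e} (inj₁ eqn) refl = noLoop G e (trans (cong proj₁ eqn) (sym (cong proj₂ eqn)))
  joins-irrefl {e} (inj₂ eqn) refl = noLoop G e (trans (cong proj₁ eqn) (sym (cong proj₂ eqn)))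

  joins-unique : ∀ {e e' u w} → Joins e u w → Joins e' u w → e ≡ e'
  joins-unique (inj₁ p) (inj₁ q) = noMulti G _ _ (inj₁ (trans p (sym q)))
  joins-unique (inj₁ p) (inj₂ q) = noMulti G _ _ (inj₂ (trans p (cong swap (sym q))))
  joins-unique (inj₂ p) (inj₁ q) = noMulti G _ _ (inj₂ (trans p (cong swap (sym q))))
  joins-unique (inj₂ p) (inj₂ q) = noMulti G _ _ (inj₁ (trans p (sym q)))

  joins-incˡ : ∀ {e u w} → Joins e u w → Inc G (inj₁ u) (inj₂ e)
  joins-incˡ (inj₁ eqn) = inj₁ (cong proj₁ eqn)
  joins-incˡ (inj₂ eqn) = inj₂ (cong proj₂ eqn)

  inc-joins : ∀ {e u w v} → Joins e u w → Inc G (inj₁ v) (inj₂ e) → v ≡ u ⊎ v ≡ w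
  inc-joins (inj₁ eqn) (inj₁ i) = inj₁ (trans (sym i) (cong proj₁ eqn))
  inc-joins (inj₁ eqn) (inj₂ i) = inj₂ (trans (sym i) (cong proj₂ eqn))
  inc-joins (inj₂ eqn) (inj₁ i) = inj₂ (trans (sym i) (cong proj₁ eqn))
  inc-joins (inj₂ eqn) (inj₂ i) = inj₁ (trans (sym i) (cong proj₂ eqn))

  ends-joins : ∀ e → Joins e (proj₁ (ends G e)) (proj₂ (ends G e))
  ends-joins e = inj₁ refl

  inc⇒joins : ∀ {e u} → Inc G (inj₁ u) (inj₂ e) → ∃[ w ] Joins e u w
  inc⇒joins (inj₁ i) = _ , inj₁ (cong₂ _,_ i refl)
  inc⇒joins (inj₂ i) = _ , inj₂ (cong₂ _,_ refl i)

  joins-inc : ∀ {e u w} → u ≢ w → Inc G (inj₁ u) (inj₂ e) → Inc G (inj₁ w) (inj₂ e) → Joins e u w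
  joins-inc u≢w iu iw with inc⇒joins iu
  ... | w' , j with inc-joins j iw
  ...   | inj₁ w≡u  = contradiction (sym w≡u) u≢w
  ...   | inj₂ refl = j

  inc? : ∀ x y → Dec (Inc G x y)
  inc? (inj₁ v) (inj₂ e) = (_ ≟ v) ⊎-dec (_ ≟ v)
  inc? (inj₁ _) (inj₁ _) = no λ ()
  inc? (inj₂ _) _        = no λ ()

module Invariance (G : Graph) (π : U G → U G) (π-involutive : ∀ x → π (π x) ≡ x)
                  (π-inc : ∀ x y → Inc G x y → Inc G (π x) (π y)) where

  private variable
    k l : ℕ
    ρ ρ' : Fin k → U G
    σ σ' : Fin l → USet G

  -- Environments are compared pointwise, so the induction on formulas needs no function
  -- extensionality.
  Moves₁ : (ρ ρ' : Fin k → U G) → Set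
  Moves₁ ρ ρ' = ∀ i → π (ρ i) ≡ ρ' i

  Moves₂ : (σ σ' : Fin l → USet G) → Set
  Moves₂ σ σ' = ∀ c x → σ c x ≡ σ' c (π x)

  sym₁ : Moves₁ ρ ρ' → Moves₁ ρ' ρ
  sym₁ h i = trans (cong π (sym (h i))) (π-involutive _)

  sym₂ : Moves₂ σ σ' → Moves₂ σ' σ
  sym₂ {σ' = σ'} h c x = trans (cong (σ' c) (sym (π-involutive x))) (sym (h c (π x)))

  ext₁ : ∀ {a b} → Moves₁ ρ ρ' → π a ≡ b → Moves₁ (ρ ▸ a) (ρ' ▸ b)
  ext₁ h eqn zero    = eqn
  ext₁ h eqn (suc i) = h i

  ext₂ : ∀ {P Q} → Moves₂ σ σ' → (∀ x → P x ≡ Q (π x)) → Moves₂ (σ ▸ P) (σ' ▸ Q)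
  ext₂ h eqn zero    = eqn
  ext₂ h eqn (suc i) = h i

  -- Negation reverses the direction of transfer; since `π` is an involution, `sym₁` and `sym₂`
  -- supply the reverse for the same `π`. Quantified sets are transported by composition with `π`.
  sat-invariant : (φ : Formula k l) → Moves₁ ρ ρ' → Moves₂ σ σ' → Sat G φ ρ σ → Sat G φ ρ' σ'
  sat-invariant (eq i j) h₁ h₂ s = trans (sym (h₁ i)) (trans (cong π s) (h₁ j))
  sat-invariant (inc i j) h₁ h₂ s rewrite sym (h₁ i) | sym (h₁ j) = π-inc _ _ s
  sat-invariant (mem i c) h₁ h₂ s rewrite sym (h₁ i) = trans (sym (h₂ c _)) s
  sat-invariant (neg φ) h₁ h₂ s = s ∘ sat-invariant φ (sym₁ h₁) (sym₂ h₂)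
  sat-invariant (and φ ψ) h₁ h₂ (s , t) = sat-invariant φ h₁ h₂ s , sat-invariant ψ h₁ h₂ t
  sat-invariant (or φ ψ) h₁ h₂ (inj₁ s) = inj₁ (sat-invariant φ h₁ h₂ s)
  sat-invariant (or φ ψ) h₁ h₂ (inj₂ s) = inj₂ (sat-invariant ψ h₁ h₂ s)
  sat-invariant (ex₁ φ) h₁ h₂ (a , s) = π a , sat-invariant φ (ext₁ h₁ refl) h₂ s
  sat-invariant (ex₂ φ) h₁ h₂ (P , s) =
    P ∘ π , sat-invariant φ h₁ (ext₂ h₂ λ x → cong P (sym (π-involutive x))) s
  sat-invariant (all₁ φ) h₁ h₂ s b =
    sat-invariant φ (ext₁ h₁ (π-involutive b)) h₂ (s (π b))
  sat-invariant (all₂ φ) h₁ h₂ s Q =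
    sat-invariant φ h₁ (ext₂ h₂ λ x → refl) (s (Q ∘ π))

module Swap (G : Graph) {l} (σ : Fin l → USet G) where

  open Edges G

  -- The clause `w ≢ v'` makes twins non-adjacent, so exchanging them fixes the other end of every
  -- edge at either one. The condition is one-sided; the swap assumes it both ways.
  Twin : Fin (n G) → Fin (n G) → Set
  Twin v v' = ∀ e w → Joins e v w → w ≢ v' ×
    Σ (Fin (m G)) λ e' → Joins e' v' w × (∀ c → σ c (inj₂ e) ≡ σ c (inj₂ e'))

  module _ {v v'} (v≢v' : v ≢ v') (tw : Twin v v') (tw' : Twin v' v)
           (σv : ∀ c → σ c (inj₁ v) ≡ σ c (inj₁ v')) where

    τ : Fin (n G) → Fin (n G)
    τ x with x ≟ v | x ≟ v'
    ... | yes _ | _     = v'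
    ... | no _  | yes _ = v
    ... | no _  | no _  = x

    τ-v : τ v ≡ v'
    τ-v with v ≟ v
    ... | yes _ = refl
    ... | no v≢ = contradiction refl v≢

    τ-v' : τ v' ≡ v
    τ-v' with v' ≟ v | v' ≟ v'
    ... | yes eqn | _     = contradiction (sym eqn) v≢v'
    ... | no _   | yes _ = refl
    ... | no _   | no ¬r = contradiction refl ¬r

    τ-fix : ∀ {x} → x ≢ v → x ≢ v' → τ x ≡ x
    τ-fix {x} ≢v ≢v' with x ≟ v | x ≟ v'
    ... | yes eqn | _      = contradiction eqn ≢v
    ... | no _   | yes eqn = contradiction eqn ≢v'
    ... | no _   | no _   = refl

    data View : Fin (n G) → Set where
      isv  : View v
      isv' : View v'
      other : ∀ {x} → x ≢ v → x ≢ v' → View x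

    view : ∀ x → View x
    view x with x ≟ v | x ≟ v'
    ... | yes refl | _        = isv
    ... | no _     | yes refl = isv'
    ... | no ≢v    | no ≢v'   = other ≢v ≢v'

    τ-involutive : ∀ x → τ (τ x) ≡ x
    τ-involutive x with view x
    ... | isv  = trans (cong τ τ-v) τ-v'
    ... | isv' = trans (cong τ τ-v') τ-v
    ... | other ≢v ≢v' = trans (cong τ (τ-fix ≢v ≢v')) (τ-fix ≢v ≢v')

    τ-injective : ∀ {x y} → τ x ≡ τ y → x ≡ y
    τ-injective eqn = trans (sym (τ-involutive _)) (trans (cong τ eqn) (τ-involutive _))

    Image : Fin (m G) → Fin (n G) → Fin (n G) → Set
    Image e x y = Σ (Fin (m G)) λ e' →
      Joins e' (τ x) (τ y) × (∀ c → σ c (inj₂ e) ≡ σ c (inj₂ e'))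

    image-v : ∀ {e w} → Joins e v w → Image e v w
    image-v j with tw _ _ j
    ... | w≢v' , e' , j' , col
      rewrite τ-v | τ-fix (joins-irrefl j ∘ sym) w≢v' = e' , j' , col

    image-v' : ∀ {e w} → Joins e v' w → Image e v' w
    image-v' j with tw' _ _ j
    ... | w≢v , e' , j' , col
      rewrite τ-v' | τ-fix w≢v (joins-irrefl j ∘ sym) = e' , j' , col

    image-sym : ∀ {e} x y → Image e x y → Image e y x
    image-sym _ _ (e' , j , col) = e' , joins-sym j , col

    -- The twin conditions cover every edge at `v` or `v'`; every other edge is its own image.
    image : ∀ {e x y} → Joins e x y → Image e x y
    image {e} {x} {y} j with view x | view y
    ... | isv        | _    = image-v j
    ... | isv'       | _    = image-v' j
    ... | other _ _  | isv  = image-sym y x (image-v (joins-sym j))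
    ... | other _ _  | isv' = image-sym y x (image-v' (joins-sym j))
    ... | other p p' | other q q' rewrite τ-fix p p' | τ-fix q q' = e , j , λ _ → refl

    π : U G → U G
    π (inj₁ x) = inj₁ (τ x)
    π (inj₂ e) = inj₂ (proj₁ (image (ends-joins e)))

    π-joins : ∀ e → Joins (proj₁ (image (ends-joins e)))
                           (τ (proj₁ (ends G e))) (τ (proj₂ (ends G e)))
    π-joins e = proj₁ (proj₂ (image (ends-joins e)))

    π-inc : ∀ x y → Inc G x y → Inc G (π x) (π y)
    π-inc (inj₁ x) (inj₂ e) (inj₁ refl) = joins-incˡ (π-joins e)
    π-inc (inj₁ x) (inj₂ e) (inj₂ refl) = joins-incˡ (joins-sym (π-joins e))

    -- The image of an edge is chosen from its stored orientation; this removes that dependence.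
    -- Applied to the image of `e`, it shows that applying `π` twice gives an edge with the ends of
    -- `e`, hence `e` itself.
    π-joins' : ∀ {e x y} → Joins e x y → Joins (proj₁ (image (ends-joins e))) (τ x) (τ y)
    π-joins' {e} j = joins-inc (joins-irrefl j ∘ τ-injective)
      (π-inc _ (inj₂ e) (joins-incˡ j)) (π-inc _ (inj₂ e) (joins-incˡ (joins-sym j)))

    π-involutive : ∀ x → π (π x) ≡ x
    π-involutive (inj₁ x) = cong inj₁ (τ-involutive x)
    π-involutive (inj₂ e) = cong inj₂ (joins-unique
      (subst₂ (Joins _) (τ-involutive _) (τ-involutive _) (π-joins' (π-joins e)))
      (ends-joins e))

    π-colour : ∀ c x → σ c x ≡ σ c (π x)
    π-colour c (inj₁ x) with view x
    ... | isv  = trans (σv c) (cong (σ c ∘ inj₁) (sym τ-v))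
    ... | isv' = trans (sym (σv c)) (cong (σ c ∘ inj₁) (sym τ-v'))
    ... | other p q = cong (σ c ∘ inj₁) (sym (τ-fix p q))
    π-colour c (inj₂ e) = proj₂ (proj₂ (image (ends-joins e))) c

    twins-indiscernible : (φ : Formula 2 l) →
      Sat G φ (pair (inj₁ v) (inj₁ v')) σ → Sat G φ (pair (inj₁ v') (inj₁ v)) σ
    twins-indiscernible φ = Invariance.sat-invariant G π π-involutive π-inc φ
      (λ { zero → cong inj₁ τ-v ; (suc _) → cong inj₁ τ-v' }) π-colour

-- Few components from an ordering

module Forward (G : Graph) {l} (φ : Formula 2 l) (σ : Fin l → USet G)
               (order : IsTotalOrder _≡_ (λ a b → Sat G φ (pair a b) σ))
               (split : IsSplit G) where

  open Edges G
  open Swap G σ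
  private module O = IsTotalOrder order

  -- Totality orders the two vertices one way, the swap then orders them the other way too, and
  -- antisymmetry identifies them.
  not-twins : ∀ {v v'} → v ≢ v' → Twin v v' → Twin v' v →
              ¬ (∀ c → σ c (inj₁ v) ≡ σ c (inj₁ v'))
  not-twins {v} {v'} v≢v' tw tw' σv with O.total (inj₁ v) (inj₁ v')
  ... | inj₁ s = v≢v' (inj₁-injective (O.antisym s
                   (twins-indiscernible v≢v' tw tw' σv φ s)))
  ... | inj₂ s = v≢v' (inj₁-injective (O.antisym
                   (twins-indiscernible (v≢v' ∘ sym) tw' tw (sym ∘ σv) φ s) s))

  module _ (S : Subset (n G)) where

    Exits : Fin (n G) → Set
    Exits v = Σ (Fin (n G)) λ w → w ∉ S × Adj G v w

    exits? : ∀ v → Dec (Exits v)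
    exits? v = any? λ w → ¬? (w ∈? S) ×-dec adj? v w

    -- Colour zero makes type record the neighbourhood in S.
    Colour : Fin (suc l) → Fin (m G) → Set
    Colour zero    e = true ≡ true
    Colour (suc c) e = σ c (inj₂ e) ≡ true

    colour? : ∀ c e → Dec (Colour c e)
    colour? zero    e = yes refl
    colour? (suc c) e = σ c (inj₂ e) Bool.≟ true

    edge? : ∀ v c w → Dec (Σ (Fin (m G)) λ e → Joins e v w × Colour c e)
    edge? v c w = any? λ e → joins? e v w ×-dec colour? c e

    -- Column zero describes the vertex itself: whether it exits, then its parameter colours. Column
    -- `suc i` describes its edge to the `i`-th element of `S`. The size of the table gives the
    -- exponent in `sep`.
    type : Fin (n G) → Fin (suc l) → Fin (suc ∣ S ∣) → Bool
    type v zero    zero    = does (exits? v)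
    type v (suc c) zero    = σ c (inj₁ v)
    type v c       (suc i) = does (edge? v c (enum S i))

    edge-transfer : ∀ {v v'} → (∀ c i → type v c i ≡ type v' c i) → ∀ {w} → w ∈ S → ∀ c e →
      Joins e v w → Colour c e → Σ (Fin (m G)) λ e' → Joins e' v' w × Colour c e'
    edge-transfer {v} {v'} eqn {w} w∈S c e j col =
      subst (λ w → Σ (Fin (m G)) λ e' → Joins e' v' w × Colour c e') (enum-rank S w∈S)
        (does⇒ (edge? v' c _) (trans (sym (eqn' c))
          (dec-true (edge? v c _) (subst (λ w → Σ (Fin (m G)) λ e → Joins e v w × Colour c e)
             (sym (enum-rank S w∈S)) (e , j , col)))))
      where
      eqn' : ∀ c → does (edge? v c (enum S (rank S w∈S))) ≡ does (edge? v' c (enum S (rank S w∈S)))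
      eqn' zero    = eqn zero (suc (rank S w∈S))
      eqn' (suc c) = eqn (suc c) (suc (rank S w∈S))

    -- A vertex that does not exit has all its edges into `S`. Row zero provides the partner edge
    -- and the other rows its colours; since the graph is simple, the edges found for different rows
    -- coincide.
    type⇒twin : ∀ {v v'} → v ∉ S → v' ∉ S → ¬ Exits v →
      (∀ c i → type v c i ≡ type v' c i) → Twin v v'
    type⇒twin {v} {v'} v∉S v'∉S ¬ex eqn e w j with w ∈? S
    ... | no w∉S  = contradiction (w , w∉S , e , j) ¬ex
    ... | yes w∈S with edge-transfer eqn w∈S zero e j refl
    ...   | e' , j' , _ = (λ { refl → v'∉S w∈S }) , e' , j' , λ c → ≡-from-true
      (λ col → let e'' , j'' , col'' = edge-transfer eqn w∈S (suc c) e j col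
               in subst (Colour (suc c)) (joins-unique j'' j') col'')
      (λ col → let e'' , j'' , col'' = edge-transfer (λ c i → sym (eqn c i)) w∈S (suc c) e' j' col
               in subst (Colour (suc c)) (joins-unique j'' j) col'')

    _⟶_ : Fin (n G) → Fin (n G) → Set
    _⟶_ = Reach G S

    -- Both directions of reachability are stored, which avoids proving that `Reach` is symmetric.
    Hub : Fin (n G) → Set
    Hub v = Σ (Fin (n G)) λ w → w ∈ proj₁ split × w ∉ S × (v ⟶ w) × (w ⟶ v)

    -- Every edge of a split graph has an end in the clique, and that end is the hub.
    exits⇒hub : ∀ {v} → v ∉ S → Exits v → Hub v
    exits⇒hub {v} v∉S (w , w∉S , a) with v ∈? proj₁ split | w ∈? proj₁ split
    ... | yes v∈A | _       = v , v∈A , v∉S , here v∉S , here v∉S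
    ... | no _    | yes w∈A =
      w , w∈A , w∉S , step v∉S a (here w∉S) , step w∉S (adj-sym a) (here v∉S)
    ... | no v∉A  | no w∉A  = contradiction a (proj₂ (proj₂ split) v w v∉A w∉A)

    ⟶-trans : ∀ {u v w} → u ⟶ v → v ⟶ w → u ⟶ w
    ⟶-trans (here _)         vw = vw
    ⟶-trans (step u∉ a uv) vw = step u∉ a (⟶-trans uv vw)

    hubs-connected : ∀ {u v} → Hub u → Hub v → u ⟶ v
    hubs-connected (x , x∈A , x∉S , ux , _) (y , y∈A , y∉S , _ , yv) with x ≟ y
    ... | yes refl = ⟶-trans ux yv
    ... | no x≢y   = ⟶-trans ux (step x∉S (proj₁ (proj₂ split) x y x∈A y∈A x≢y) yv)

  -- Pigeonhole on types. Two representatives of equal type either both exit, and then share the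
  -- component of the clique, or neither does, and then they are twins of equal colour.
  sep : HasSEP (λ k → 2 ^ (suc l * suc k)) G
  sep k S ∣S∣≤k r r∉S apart = conflict (pigeonhole few (encode ∘ type S ∘ r))
    where
    few : 2 ^ (suc l * suc ∣ S ∣) < suc (2 ^ (suc l * suc k))
    few = s≤s (ℕ.^-monoʳ-≤ 2 (ℕ.*-monoʳ-≤ (suc l) (s≤s ∣S∣≤k)))

    conflict : (∃[ i ] ∃[ j ] (i Fin.< j × encode (type S (r i)) ≡ encode (type S (r j)))) → ⊥
    conflict (i , j , i<j , same) with encode-injective same | exits? S (r i) | exits? S (r j)
    ... | eqn | yes ex | yes ex' =
      <⇒≢ i<j (apart i j (hubs-connected S (exits⇒hub S (r∉S i) ex) (exits⇒hub S (r∉S j) ex')))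
    ... | eqn | yes ex | no ¬ex' =
      ¬ex' (does⇒ (exits? S (r j)) (trans (sym (eqn zero zero))
        (dec-true (exits? S (r i)) ex)))
    ... | eqn | no ¬ex | _ =
      not-twins ri≢rj (type⇒twin S (r∉S i) (r∉S j) ¬ex eqn)
        (type⇒twin S (r∉S j) (r∉S i) ¬ex' (λ c i → sym (eqn c i)))
        (λ c → eqn (suc c) zero)
      where
      ri≢rj : r i ≢ r j
      ri≢rj ri≡rj = <⇒≢ i<j (apart i j (subst (Reach G S (r i)) ri≡rj (here (r∉S i))))
      ¬ex' : ¬ Exits S (r j)
      ¬ex' ex = ¬ex (does⇒ (exits? S (r i)) (trans (eqn zero zero) (dec-true (exits? S (r j)) ex)))

-- Order-defining formulas

-- Polymorphism in the number of element variables lets a formula be reused under quantifiers by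
-- shifting its arguments, without a substitution operation.
Form₁ Form₂ : ℕ → Set
Form₁ l = ∀ {k} → Fin k → Formula k l
Form₂ l = ∀ {k} → Fin k → Fin k → Formula k l

infixr 3 _⇒_
_⇒_ : ∀ {k l} → Formula k l → Formula k l → Formula k l
φ ⇒ ψ = or (neg φ) ψ

bit : ∀ {l} → Fin l → Form₂ l
bit c i j = mem i c ⇒ mem j c

-- Lexicographic combination: `ψ` decides only where `φ` ties.
then : ∀ {l} → Form₂ l → Form₂ l → Form₂ l
then φ ψ i j = and (φ i j) (φ j i ⇒ ψ i j)

chain : ∀ {l} t → (Fin t → Form₂ l) → Form₂ l → Form₂ l
chain ℕ.zero  φs ψ = ψ
chain (suc t) φs ψ = then (φs zero) (chain t (λ c → φs (suc c)) ψ)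

-- Lexicographic comparison of 0-1 sequences: the positions are the elements of `δ` ordered by `ψ`,
-- and `β i p` is the digit of `i` at `p`. At each position before which the digits all agree, a
-- digit of `i` must be a digit of `j`.
lex : ∀ {l} → Form₁ l → Form₂ l → Form₂ l → Form₂ l
lex δ ψ β i j = all₁ (δ zero ⇒
  (all₁ (δ zero ⇒ and (ψ zero (suc zero)) (neg (ψ (suc zero) zero)) ⇒
     and (β (suc (suc i)) zero ⇒ β (suc (suc j)) zero)
         (β (suc (suc j)) zero ⇒ β (suc (suc i)) zero))
   ⇒ β (suc i) zero ⇒ β (suc j) zero))

-- The set f codes a symmetric relation on the clique a: edges stand for the pairs
-- they join, vertices for the diagonal.
row : ∀ {l} → Fin l → Fin l → Form₂ l
row a f i j = or (and (eq i j) (and (mem i a) (mem i f)))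
  (ex₁ (and (mem zero f)
    (and (inc (suc i) zero) (and (inc (suc j) zero) (neg (eq (suc i) (suc j)))))))

nested : ∀ {l} → Fin l → Fin l → Form₂ l
nested a f i j = all₁ (row a f (suc i) zero ⇒ row a f (suc j) zero)

link : ∀ {l} → Fin l → Form₂ l
link c i j = ex₁ (and (mem zero c) (and (inc (suc i) zero) (inc (suc j) zero)))

-- Implication is coded as a disjunction, so a decision of the antecedent is needed to choose the
-- disjunct.
⇒-⇔ : ∀ {A B S T : Set} → Dec A → S ⇔ A → T ⇔ B → (¬ S ⊎ T) ⇔ (A → B)
⇒-⇔ a? S⇔A T⇔B = mk⇔
  (λ { (inj₁ ¬s) a → contradiction (from S⇔A a) ¬s ; (inj₂ t) _ → to T⇔B t })
  (λ f → case a? of λ { (yes a) → inj₂ (from T⇔B (f a)) ; (no ¬a) → inj₁ (¬a ∘ to S⇔A) })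

¬-⇔ : ∀ {A S : Set} → S ⇔ A → (¬ S) ⇔ (¬ A)
¬-⇔ e = mk⇔ (_∘ from e) (_∘ to e)

∀-⇔ : ∀ {X : Set} {S A : X → Set} → (∀ x → S x ⇔ A x) → (∀ x → S x) ⇔ (∀ x → A x)
∀-⇔ e = mk⇔ (λ s x → to (e x) (s x)) (λ a x → from (e x) (a x))

-- Definable total preorders

module Definability (G : Graph) {l} (σ : Fin l → USet G) where

  any-U? : {P : U G → Set} → (∀ x → Dec (P x)) → Dec (Σ (U G) P)
  any-U? P? = map′
    [ (λ (v , p) → inj₁ v , p) , (λ (e , p) → inj₂ e , p) ]′
    (λ { (inj₁ v , p) → inj₁ (v , p) ; (inj₂ e , p) → inj₂ (e , p) })
    (any? (P? ∘ inj₁) ⊎-dec any? (P? ∘ inj₂))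

  all-U? : {P : U G → Set} → (∀ x → Dec (P x)) → Dec (∀ x → P x)
  all-U? P? = map′ (λ (p , q) → [ p , q ]) (λ p → p ∘ inj₁ , p ∘ inj₂)
    (all? (P? ∘ inj₁) ×-dec all? (P? ∘ inj₂))

  Defines₁ : Form₁ l → (U G → Set) → Set
  Defines₁ φ D = ∀ {k} (ρ : Fin k → U G) i → Sat G (φ i) ρ σ ⇔ D (ρ i)

  Defines₂ : Form₂ l → (U G → U G → Set) → Set
  Defines₂ φ R = ∀ {k} (ρ : Fin k → U G) i j → Sat G (φ i j) ρ σ ⇔ R (ρ i) (ρ j)

  -- Preorders, not orders, so that coarse comparisons can be refined one after another;
  -- antisymmetry is derived at the end from the kernels.
  record Preorder (φ : Form₂ l) : Set₁ where
    infix 4 _≼_ _≺_ _≼?_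
    field
      _≼_     : U G → U G → Set
      _≼?_    : ∀ x y → Dec (x ≼ y)
      total   : ∀ x y → x ≼ y ⊎ y ≼ x
      ≼-trans : ∀ {x y z} → x ≼ y → y ≼ z → x ≼ z
      defines : Defines₂ φ _≼_

    ≼-refl : ∀ {x} → x ≼ x
    ≼-refl {x} = [ (λ p → p) , (λ p → p) ]′ (total x x)

    _≺_ : U G → U G → Set
    x ≺ y = x ≼ y × ¬ y ≼ x

    ≺-trans : ∀ {x y z} → x ≺ y → y ≺ z → x ≺ z
    ≺-trans (p , ¬p) (q , ¬q) = ≼-trans p q , λ r → ¬p (≼-trans q r)

    -- The universe is finite: `join` carries the relation to a strict partial order on
    -- `Fin (n G + m G)`.
    ≺-wellFounded : WellFounded _≺_
    ≺-wellFounded = Subrelation.wellFounded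
      (subst₂ _≺_ (sym (splitAt-join (n G) (m G) _)) (sym (splitAt-join (n G) (m G) _)))
      (On.wellFounded (join (n G) (m G)) (spo-wellFounded strict))
      where
      strict : IsStrictPartialOrder _≡_ (λ i j → splitAt (n G) i ≺ splitAt (n G) j)
      strict = record
        { isEquivalence = isEquivalence
        ; irrefl        = λ { refl (p , ¬p) → ¬p p }
        ; trans         = ≺-trans
        ; <-resp-≈      = (λ { refl p → p }) , (λ { refl p → p })
        }

  open Preorder

  infix 4 _⊢_≈_
  -- The kernel of a preorder: the pairs that it leaves tied.
  record _⊢_≈_ {φ : Form₂ l} (P : Preorder φ) (x y : U G) : Set where
    constructor _,_
    field
      fst : _≼_ P x y
      snd : _≼_ P y x

  ≈-sym : ∀ {φ : Form₂ l} {P : Preorder φ} {x y} → P ⊢ x ≈ y → P ⊢ y ≈ x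
  ≈-sym (p , q) = q , p

  bit-preorder : ∀ c → Preorder (bit c)
  bit-preorder c = record
    { _≼_     = λ x y → σ c x ≡ true → σ c y ≡ true
    ; _≼?_    = λ x y → (σ c x Bool.≟ true) →-dec (σ c y Bool.≟ true)
    ; total   = λ x y → tot (σ c x) (σ c y)
    ; ≼-trans = λ p q → q ∘ p
    ; defines = λ ρ i j → ⇒-⇔ (σ c (ρ i) Bool.≟ true) (⇔-id _) (⇔-id _)
    }
    where
    tot : ∀ a b → (a ≡ true → b ≡ true) ⊎ (b ≡ true → a ≡ true)
    tot a true  = inj₁ λ _ → refl
    tot a false = inj₂ λ ()

  module _ {φ ψ : Form₂ l} (P : Preorder φ) (Q : Preorder ψ) where

    private
      module P = Preorder P
      module Q = Preorder Q

    then-preorder : Preorder (then φ ψ)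
    then-preorder = record
      { _≼_     = λ x y → x P.≼ y × (y P.≼ x → x Q.≼ y)
      ; _≼?_    = λ x y → (x P.≼? y) ×-dec ((y P.≼? x) →-dec (x Q.≼? y))
      ; total   = tot
      ; ≼-trans = λ (p , q) (p' , q') → P.≼-trans p p' ,
          λ r → Q.≼-trans (q (P.≼-trans p' r)) (q' (P.≼-trans r p))
      ; defines = λ ρ i j → P.defines ρ i j ×-⇔
          ⇒-⇔ (ρ j P.≼? ρ i) (P.defines ρ j i) (Q.defines ρ i j)
      }
      where
      tot : ∀ x y → (x P.≼ y × (y P.≼ x → x Q.≼ y)) ⊎ (y P.≼ x × (x P.≼ y → y Q.≼ x))
      tot x y with x P.≼? y | y P.≼? x
      ... | yes p | no ¬q = inj₁ (p , λ q → contradiction q ¬q)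
      ... | no ¬p | yes q = inj₂ (q , λ p → contradiction p ¬p)
      ... | yes p | yes q = [ (λ r → inj₁ (p , λ _ → r)) , (λ r → inj₂ (q , λ _ → r)) ]′ (Q.total x y)
      ... | no ¬p | no ¬q = ⊥-elim ([ ¬p , ¬q ]′ (P.total x y))

    then-kernel : ∀ {x y} → then-preorder ⊢ x ≈ y → P ⊢ x ≈ y × Q ⊢ x ≈ y
    then-kernel ((p , q) , (p' , q')) = (p , p') , (q p' , q' p)

  chain-preorder : ∀ t {φs : Fin t → Form₂ l} {ψ : Form₂ l} →
    (∀ c → Preorder (φs c)) → Preorder ψ → Preorder (chain t φs ψ)
  chain-preorder ℕ.zero  Ps Q = Q
  chain-preorder (suc t) Ps Q = then-preorder (Ps zero) (chain-preorder t (λ c → Ps (suc c)) Q)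

  chain-kernel : ∀ t {φs : Fin t → Form₂ l} {ψ : Form₂ l} (Ps : ∀ c → Preorder (φs c)) (Q : Preorder ψ) →
    ∀ {x y} → chain-preorder t Ps Q ⊢ x ≈ y → (∀ c → Ps c ⊢ x ≈ y) × Q ⊢ x ≈ y
  chain-kernel ℕ.zero  Ps Q e = (λ ()) , e
  chain-kernel (suc t) Ps Q e
    with then-kernel (Ps zero) (chain-preorder t (λ c → Ps (suc c)) Q) e
  ... | e₀ , es with chain-kernel t (λ c → Ps (suc c)) Q es
  ...   | es' , e' = (λ { zero → e₀ ; (suc c) → es' c }) , e'

  module Lex {δ : Form₁ l} {ψ β : Form₂ l}
    (D : U G → Set) (D? : ∀ x → Dec (D x)) (D-defines : Defines₁ δ D)
    (P : Preorder ψ)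
    (antisym : ∀ {i j} → D i → D j → P ⊢ i ≈ j → i ≡ j)
    (B : U G → U G → Set) (B? : ∀ x i → Dec (B x i)) (B-defines : Defines₂ β B) where

    private module P = Preorder P

    Agree : U G → U G → U G → Set
    Agree x y i = (B x i → B y i) × (B y i → B x i)

    Below : U G → U G → U G → Set
    Below x y i = ∀ j → D j → j P.≺ i → Agree x y j

    below? : ∀ x y i → Dec (Below x y i)
    below? x y i = all-U? λ j → D? j →-dec ((j P.≼? i) ×-dec ¬? (i P.≼? j)) →-dec
      ((B? x j →-dec B? y j) ×-dec (B? y j →-dec B? x j))

    _⊑_ : U G → U G → Set
    x ⊑ y = ∀ i → D i → Below x y i → B x i → B y i

    ⊑? : ∀ x y → Dec (x ⊑ y)
    ⊑? x y = all-U? λ i → D? i →-dec below? x y i →-dec B? x i →-dec B? y i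

    below-swap : ∀ {x y i} → Below x y i → Below y x i
    below-swap b j Dj j≺i = swap (b j Dj j≺i)

    -- Agreement of `x` and `z` below `i` forces `y` to agree with both: at each earlier position,
    -- by well-founded induction, the implications from `x` to `y`, `y` to `z` and `z` to `x` close
    -- a cycle.
    ⊑-trans : ∀ {x y z} → x ⊑ y → y ⊑ z → x ⊑ z
    ⊑-trans {x} {y} {z} p q i Di xz =
      q i Di (λ j Dj j≺i → proj₂ (both j (P.≺-wellFounded j) Dj j≺i)) ∘
      p i Di (λ j Dj j≺i → proj₁ (both j (P.≺-wellFounded j) Dj j≺i))
      where
      both : ∀ j → Acc P._≺_ j → D j → j P.≺ i → Agree x y j × Agree y z j
      both j (acc rs) Dj j≺i = (x→y , z→x ∘ y→z) , (y→z , x→y ∘ z→x)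
        where
        x→y = p j Dj λ j' Dj' j'≺j → proj₁ (both j' (rs j'≺j) Dj' (P.≺-trans j'≺j j≺i))
        y→z = q j Dj λ j' Dj' j'≺j → proj₂ (both j' (rs j'≺j) Dj' (P.≺-trans j'≺j j≺i))
        z→x = proj₂ (xz j Dj j≺i)

    -- A failure of `x ⊑ y` yields a first difference `i`, with the digit in `x` only. For `y ⊑ x`,
    -- positions before `i` agree, positions after `i` impose nothing, and a position tied with `i`
    -- is `i` by antisymmetry.
    ⊑-total : ∀ x y → x ⊑ y ⊎ y ⊑ x
    ⊑-total x y with any-U? (λ i → D? i ×-dec below? x y i ×-dec B? x i ×-dec ¬? (B? y i))
    ... | no none = inj₁ λ i Di xy xi → decidable-stable (B? y i) λ ¬yi → none (i , Di , xy , xi , ¬yi)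
    ... | yes (i , Di , xy , xi , ¬yi) = inj₂ y⊑x
      where
      y⊑x : y ⊑ x
      y⊑x k Dk yx yk with k P.≼? i | i P.≼? k
      ... | yes p | no ¬q = proj₂ (xy k Dk (p , ¬q)) yk
      ... | no ¬p | yes q = contradiction (proj₂ (yx i Di (q , ¬p)) xi) ¬yi
      ... | yes p | yes q rewrite antisym Dk Di (p , q) = contradiction yk ¬yi
      ... | no ¬p | no ¬q = ⊥-elim ([ ¬p , ¬q ]′ (P.total k i))

    lex-preorder : Preorder (lex δ ψ β)
    lex-preorder = record
      { _≼_     = _⊑_
      ; _≼?_    = ⊑?
      ; total   = ⊑-total
      ; ≼-trans = ⊑-trans
      ; defines = λ ρ x y → ∀-⇔ λ i → ⇒-⇔ (D? i) (D-defines (ρ ▸ i) zero)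
          (⇒-⇔ (below? (ρ x) (ρ y) i)
            (∀-⇔ λ j → let ρ' = (ρ ▸ i) ▸ j in
              ⇒-⇔ (D? j) (D-defines ρ' zero)
              (⇒-⇔ ((j P.≼? i) ×-dec ¬? (i P.≼? j))
                (P.defines ρ' zero (suc zero) ×-⇔ ¬-⇔ (P.defines ρ' (suc zero) zero))
                (⇒-⇔ (B? (ρ x) j) (B-defines ρ' (suc (suc x)) zero) (B-defines ρ' (suc (suc y)) zero)
                 ×-⇔
                 ⇒-⇔ (B? (ρ y) j) (B-defines ρ' (suc (suc y)) zero) (B-defines ρ' (suc (suc x)) zero))))
            (⇒-⇔ (B? (ρ x) i) (B-defines (ρ ▸ i) (suc x) zero) (B-defines (ρ ▸ i) (suc y) zero)))
      }

    -- Well-founded induction: agreement at all earlier positions releases both implications at `i`.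
    lex-kernel : ∀ {x y} → lex-preorder ⊢ x ≈ y → ∀ {i} → D i → Agree x y i
    lex-kernel {x} {y} (p , q) Di = agree _ (P.≺-wellFounded _) Di
      where
      agree : ∀ i → Acc P._≺_ i → D i → Agree x y i
      agree i (acc rs) Di = p i Di below , q i Di (below-swap below)
        where
        below : Below x y i
        below j Dj j≺i = agree j (rs j≺i) Dj

-- The formula for the linear order

cliqueSet thresholdSet : ∀ {l} → Fin (suc (suc l))
cliqueSet = zero
thresholdSet   = suc zero

colourSet : ∀ {l} → Fin l → Fin (suc (suc l))
colourSet c = suc (suc c)

-- First the colour of the element itself, then the sequence of its links of that colour to the
-- clique, read in the threshold order.
compare : ∀ {t} → Fin t → Form₂ (suc (suc t))
compare c = then (bit (colourSet c))
  (lex (λ i → mem i cliqueSet) (nested cliqueSet thresholdSet) (link (colourSet c)))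

vertexOrder : ∀ t → Form₂ (suc (suc t))
vertexOrder t = chain t compare (nested cliqueSet thresholdSet)

-- Colour zero will hold exactly the edges. Compared first, it puts vertices before edges, and its
-- complement supplies the positions at which tied edges are compared by their ends.
orderFormula : ∀ s → Form₂ (suc (suc (suc s)))
orderFormula s = then (vertexOrder (suc s))
  (lex (λ i → neg (mem i (colourSet zero))) (vertexOrder (suc s)) (λ i j → inc j i))

-- Ordering a split graph with few components

module Backward (G : Graph) (split : IsSplit G) (s : ℕ)
                (sep : HasSEP (λ k → 2 ^ (s * suc k)) G) where

  open Edges G

  A : Subset (n G)
  A = proj₁ split

  N : Fin (n G) → Subset (n G)
  N b = ⁅ adj? b ⁆?

  module Colouring (S : Subset (n G)) where

    InClass : Fin (n G) → Set
    InClass b = b ∉ A × N b ≡ S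

    inClass? : ∀ b → Dec (InClass b)
    inClass? b = ¬? (b ∈? A) ×-dec Vec.≡-dec Bool._≟_ (N b) S

    class : Subset (n G)
    class = ⁅ inClass? ⁆?

    isolated : ∀ {b x} → InClass b → Reach G S b x → b ≡ x
    isolated _           (here _)                            = refl
    isolated (_ , refl) (step _ a (here w∉S))       = contradiction (comprehension⁺ (adj? _) a) w∉S
    isolated (_ , refl) (step _ a (step w∉S _ _)) = contradiction (comprehension⁺ (adj? _) a) w∉S

    -- After deletion of `S` itself, each member of the class is a component of its own, so `sep` at
    -- `∣ S ∣` bounds their number.
    class-small : ∣ class ∣ ≤ 2 ^ (s * suc ∣ S ∣)
    class-small = ℕ.≮⇒≥ λ large →
      sep ∣ S ∣ S ℕ.≤-refl (λ i → enum class (inject≤ i large))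
        (λ i r∈S → outsider (member (inject≤ i large)) r∈S)
        (λ i j reach → inject≤-injective large large i j
          (enum-injective class (isolated (member (inject≤ i large)) reach)))
      where
      member : ∀ i → InClass (enum class i)
      member i = comprehension⁻ inClass? (enum-∈ class i)
      outsider : ∀ {b} → InClass b → b ∉ S
      outsider (_ , refl) b∈ = joins-irrefl (proj₂ (comprehension⁻ (adj? _) b∈)) refl

    -- The position of `b` in its class, written as a table. Column zero becomes vertex colours,
    -- column `suc i` the colours of the edge to the `i`-th neighbour. Vertices outside the class
    -- get the default `false`.
    bits : Fin (n G) → Fin s → Fin (suc ∣ S ∣) → Bool
    bits b with b ∈? class
    ... | yes b∈ = decode (inject≤ (rank class b∈) class-small)
    ... | no _   = λ _ _ → false

    bits-injective : ∀ {b b'} → InClass b → InClass b' →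
      (∀ c i → bits b c i ≡ bits b' c i) → b ≡ b'
    bits-injective {b} {b'} bc bc' same with b ∈? class | b' ∈? class
    ... | no b∉  | _       = contradiction (comprehension⁺ inClass? bc) b∉
    ... | yes _  | no b'∉  = contradiction (comprehension⁺ inClass? bc') b'∉
    ... | yes b∈ | yes b'∈ = trans (sym (enum-rank class b∈)) (trans
      (cong (enum class) (inject≤-injective class-small class-small _ _ (decode-injective {s} same)))
      (enum-rank class b'∈))

    vertexColour : Fin s → Fin (n G) → Bool
    vertexColour c b = bits b c zero

    edgeColour : Fin s → Fin (n G) → Fin (n G) → Bool
    edgeColour c b w with w ∈? S
    ... | yes w∈ = bits b c (suc (rank S w∈))
    ... | no _   = false

    edgeColour-enum : ∀ c b i → edgeColour c b (enum S i) ≡ bits b c (suc i)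
    edgeColour-enum c b i with enum S i ∈? S
    ... | yes w∈ = cong (bits b c ∘ suc) (enum-injective S (enum-rank S w∈))
    ... | no w∉  = contradiction (enum-∈ S i) w∉

    colours-separate : ∀ {b b'} → InClass b → InClass b' →
      (∀ c → vertexColour c b ≡ vertexColour c b') →
      (∀ c {w} → w ∈ S → edgeColour c b w ≡ edgeColour c b' w) → b ≡ b'
    colours-separate bc bc' v e = bits-injective bc bc' λ where
      c zero    → v c
      c (suc i) → trans (sym (edgeColour-enum c _ i))
                    (trans (e c (enum-∈ S i)) (edgeColour-enum c _ i))

  open Colouring using (vertexColour; edgeColour; colours-separate)

  -- Row i of this relation consists of the last suc i elements of A, so rows are
  -- strictly nested and inclusion of rows orders A.
  Hot : Fin (n G) → Fin (n G) → Set
  Hot u v = Σ (Fin ∣ A ∣) λ i → Σ (Fin ∣ A ∣) λ j →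
    enum A i ≡ u × enum A j ≡ v × ∣ A ∣ ≤ suc (toℕ i + toℕ j)

  hot? : ∀ u v → Dec (Hot u v)
  hot? u v = any? λ i → any? λ j →
    (enum A i ≟ u) ×-dec (enum A j ≟ v) ×-dec (∣ A ∣ ≤? suc (toℕ i + toℕ j))

  hot-sym : ∀ {u v} → Hot u v → Hot v u
  hot-sym (i , j , p , q , r) = j , i , q , p ,
    subst (λ k → ∣ A ∣ ≤ suc k) (ℕ.+-comm (toℕ i) (toℕ j)) r

  clique threshold : USet G
  clique (inj₁ v) = does (v ∈? A)
  clique (inj₂ e) = false
  threshold (inj₁ v) = does (hot? v v)
  threshold (inj₂ e) = does (hot? (proj₁ (ends G e)) (proj₂ (ends G e)))

  -- colour zero is the set E.
  colour : Fin (suc s) → USet G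
  colour zero    (inj₁ v) = false
  colour zero    (inj₂ e) = true
  colour (suc c) (inj₁ v) = vertexColour (N v) c v
  colour (suc c) (inj₂ e) =
    let x , y = ends G e in
    if does (x ∈? A) then edgeColour (N y) c y x else edgeColour (N x) c x y

  params : Fin (suc (suc (suc s))) → USet G
  params zero          = clique
  params (suc zero)    = threshold
  params (suc (suc c)) = colour c

  open Definability G params
  open Preorder

  ∈A⇒clique : ∀ {v} → v ∈ A → clique (inj₁ v) ≡ true
  ∈A⇒clique = dec-true (_ ∈? A)

  clique⇒∈A : ∀ x → clique x ≡ true → ∃[ v ] x ≡ inj₁ v × v ∈ A
  clique⇒∈A (inj₁ v) p = v , refl , does⇒ (v ∈? A) p

  threshold-joins : ∀ {e u v} → Joins e u v → threshold (inj₂ e) ≡ true ⇔ Hot u v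
  threshold-joins {e} (inj₁ p) rewrite p = mk⇔ (does⇒ (hot? _ _)) (dec-true (hot? _ _))
  threshold-joins {e} (inj₂ p) rewrite p =
    mk⇔ (hot-sym ∘ does⇒ (hot? _ _)) (dec-true (hot? _ _) ∘ hot-sym)

  Row : U G → U G → Set
  Row (inj₁ u) (inj₁ v) = Hot u v
  Row _        _        = ⊥

  row? : ∀ x y → Dec (Row x y)
  row? (inj₁ u) (inj₁ v) = hot? u v
  row? (inj₁ _) (inj₂ _) = no λ ()
  row? (inj₂ _) _        = no λ ()

  -- Off the diagonal, the pairs of the relation are pairs of distinct clique vertices, so each has
  -- an edge to carry it.
  row-defines : Defines₂ (row cliqueSet thresholdSet) Row
  row-defines ρ i j with ρ i | ρ j
  ... | inj₂ e | y = mk⇔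
    (λ { (inj₁ (_ , () , _)) ; (inj₂ (_ , _ , () , _)) }) λ ()
  ... | inj₁ u | inj₂ e = mk⇔
    (λ { (inj₁ (() , _)) ; (inj₂ (_ , _ , _ , () , _)) }) λ ()
  ... | inj₁ u | inj₁ v = mk⇔
    (λ { (inj₁ (refl , _ , p)) → does⇒ (hot? u u) p
       ; (inj₂ (inj₂ e , p , iu , iv , u≢v)) →
           to (threshold-joins (joins-inc (u≢v ∘ cong inj₁) iu iv)) p })
    λ h → hot⇒ h (u ≟ v)
    where
    hot⇒ : Hot u v → Dec (u ≡ v) → _
    hot⇒ h (yes refl) = inj₁ (refl , ∈A⇒clique (hot-∈ h) , dec-true (hot? u u) h)
      where hot-∈ : ∀ {w} → Hot u w → u ∈ A
            hot-∈ (i , _ , p , _) = subst (_∈ A) p (enum-∈ A i)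
    hot⇒ h@(i , j , p , q , _) (no u≢v)
      with proj₁ (proj₂ split) u v (subst (_∈ A) p (enum-∈ A i))
                                 (subst (_∈ A) q (enum-∈ A j)) u≢v
    ... | e , je = inj₂ (inj₂ e , from (threshold-joins je) h ,
      joins-incˡ je , joins-incˡ (joins-sym je) , u≢v ∘ inj₁-injective)

  -- The condition in `Hot` is monotone in the first index, so an element in row `x` but not in row
  -- `y` forces the index of `y` to be at most that of `x`.
  rows-nested : ∀ {x y k k'} → Row x k → ¬ Row y k → Row y k' → Row x k'
  rows-nested {inj₁ x} {inj₁ y} {inj₁ k} {inj₁ k'} (i , j , p , q , r) ¬yk (i' , j' , p' , q' , r') =
    i , j' , p , q' , ℕ.≤-trans r' (s≤s (ℕ.+-monoˡ-≤ (toℕ j') i'≤i))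
    where
    i'≤i : toℕ i' ≤ toℕ i
    i'≤i = ℕ.≮⇒≥ λ i<i' →
      ¬yk (i' , j , p' , q , ℕ.≤-trans r (s≤s (ℕ.+-monoˡ-≤ (toℕ j) (ℕ.<⇒≤ i<i'))))

  abstract
    nested-preorder : Preorder (nested cliqueSet thresholdSet)
    nested-preorder = record
      { _≼_     = λ x y → ∀ k → Row x k → Row y k
      ; _≼?_    = λ x y → all-U? λ k → row? x k →-dec row? y k
      ; total   = tot
      ; ≼-trans = λ p q k → q k ∘ p k
      ; defines = λ ρ i j → ∀-⇔ λ k → ⇒-⇔ (row? (ρ i) k)
          (row-defines (ρ ▸ k) (suc i) zero) (row-defines (ρ ▸ k) (suc j) zero)
      }
      where
      tot : ∀ x y → (∀ k → Row x k → Row y k) ⊎ (∀ k → Row y k → Row x k)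
      tot x y with any-U? (λ k → row? x k ×-dec ¬? (row? y k))
      ... | yes (k , xk , ¬yk) = inj₂ λ k' yk' → rows-nested {x} {y} {k} xk ¬yk yk'
      ... | no none = inj₁ λ k xk → decidable-stable (row? y k) λ ¬yk → none (k , xk , ¬yk)

    -- The index opposite to i is the least element of row i.

    nested-rank : ∀ i y → (∀ k → Row (inj₁ (enum A i)) k → Row y k) →
      Σ (Fin ∣ A ∣) λ i' → y ≡ inj₁ (enum A i') × toℕ i ≤ toℕ i'
    nested-rank i y i≼y = least y (i≼y
        (inj₁ (enum A (opposite i))) (i , opposite i , refl , refl , ℕ.≤-reflexive (sym sum)))
      where
      sum : suc (toℕ i + toℕ (opposite i)) ≡ ∣ A ∣
      sum rewrite opposite-prop i = ℕ.m+[n∸m]≡n (toℕ<n i)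
      least : ∀ y → Row y (inj₁ (enum A (opposite i))) →
        Σ (Fin ∣ A ∣) λ i' → y ≡ inj₁ (enum A i') × toℕ i ≤ toℕ i'
      least (inj₁ _) (i' , j , refl , q , r) with enum-injective A q
      ... | refl = i' , refl , ℕ.+-cancelʳ-≤ (toℕ (opposite i)) (toℕ i) (toℕ i')
          (ℕ.≤-pred (subst (_≤ suc (toℕ i' + toℕ (opposite i))) (sym sum) r))

    -- Inclusion of rows both ways gives inequalities of indices both ways. As `y` ranges over the
    -- whole universe, clique vertices are also separated from independent vertices and edges.
    nested-separates : ∀ {v y} → v ∈ A → nested-preorder ⊢ inj₁ v ≈ y → inj₁ v ≡ y
    nested-separates {v} {y} v∈A (p , q) with rank A v∈A | enum-rank A v∈A
    ... | i | refl with nested-rank i y p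
    ...   | i' , refl , i≤i' with nested-rank i' (inj₁ (enum A i)) q
    ...     | i'' , eqn , i'≤i'' with enum-injective A (inj₁-injective eqn)
    ...       | refl = cong (inj₁ ∘ enum A) (toℕ-injective (ℕ.≤-antisym i≤i' i'≤i''))

  Link : Fin (suc s) → U G → U G → Set
  Link c x y = Σ (U G) λ e → colour c e ≡ true × Inc G x e × Inc G y e

  link? : ∀ c x y → Dec (Link c x y)
  link? c x y = any-U? λ e → (colour c e Bool.≟ true) ×-dec inc? x e ×-dec inc? y e

  nested-antisym : ∀ {x y} → clique x ≡ true → clique y ≡ true → nested-preorder ⊢ x ≈ y → x ≡ y
  nested-antisym {x} x∈ _ x≈y with clique⇒∈A x x∈
  ... | v , refl , v∈A = nested-separates v∈A x≈y

  module LinkLex (c : Fin (suc s)) = Lex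
    {δ = λ i → mem i cliqueSet} {ψ = nested cliqueSet thresholdSet} {β = link (colourSet c)}
    (λ x → clique x ≡ true) (λ x → clique x Bool.≟ true) (λ ρ i → (⇔-id _))
    nested-preorder nested-antisym (Link c) (link? c) (λ ρ i j → (⇔-id _))

  abstract
    link-preorder : ∀ c → Preorder
      (lex (λ i → mem i cliqueSet) (nested cliqueSet thresholdSet) (link (colourSet c)))
    link-preorder c = LinkLex.lex-preorder c

    link-kernel : ∀ c {x y} → link-preorder c ⊢ x ≈ y →
      ∀ {a} → a ∈ A → Link c x (inj₁ a) → Link c y (inj₁ a)
    link-kernel c x≈y a∈A = proj₁ (LinkLex.lex-kernel c x≈y (∈A⇒clique a∈A))

  bit-kernel : ∀ c {x y} → bit-preorder (colourSet c) ⊢ x ≈ y → colour c x ≡ colour c y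
  bit-kernel c (p , q) = ≡-from-true p q

  abstract
    compare-preorder : ∀ c → Preorder (compare c)
    compare-preorder c = then-preorder (bit-preorder (colourSet c)) (link-preorder c)

    compare-kernel : ∀ c {x y} → compare-preorder c ⊢ x ≈ y →
      bit-preorder (colourSet c) ⊢ x ≈ y × link-preorder c ⊢ x ≈ y
    compare-kernel c = then-kernel (bit-preorder (colourSet c)) (link-preorder c)

    vertex-preorder : Preorder (vertexOrder (suc s))
    vertex-preorder = chain-preorder (suc s) compare-preorder nested-preorder

    vertex-kernel : ∀ {x y} → vertex-preorder ⊢ x ≈ y →
      (∀ c → compare-preorder c ⊢ x ≈ y) × nested-preorder ⊢ x ≈ y
    vertex-kernel = chain-kernel (suc s) compare-preorder nested-preorder

  module _ {x y} (x≈y : vertex-preorder ⊢ x ≈ y) where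

    ≈⇒nested : nested-preorder ⊢ x ≈ y
    ≈⇒nested = proj₂ (vertex-kernel x≈y)

    ≈⇒colour : ∀ c → colour c x ≡ colour c y
    ≈⇒colour c = bit-kernel c (proj₁ (compare-kernel c (proj₁ (vertex-kernel x≈y) c)))

    ≈⇒link : ∀ c {a} → a ∈ A → Link c x (inj₁ a) → Link c y (inj₁ a)
    ≈⇒link c = link-kernel c (proj₂ (compare-kernel c (proj₁ (vertex-kernel x≈y) c)))

  nbr∈A : ∀ {b w} → b ∉ A → Adj G b w → w ∈ A
  nbr∈A {b} {w} b∉A a with w ∈? A
  ... | yes w∈A = w∈A
  ... | no w∉A  = contradiction a (proj₂ (proj₂ split) b w b∉A w∉A)

  -- An edge takes its colour from the table of its second end if the first lies in `A`, and of its
  -- first end otherwise. In both orientations this is the independent end `b`, because `w` lies in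
  -- `A`.
  colour-joins : ∀ {e b w} c → b ∉ A → Joins e b w → colour (suc c) (inj₂ e) ≡ edgeColour (N b) c b w
  colour-joins {e} {b} {w} c b∉A (inj₁ p) rewrite p with b ∈? A
  ... | yes b∈A = contradiction b∈A b∉A
  ... | no _    = refl
  colour-joins {e} {b} {w} c b∉A (inj₂ p) with nbr∈A b∉A (e , inj₂ p)
  ... | w∈A rewrite p with w ∈? A
  ...   | yes _  = refl
  ...   | no w∉A = contradiction w∈A w∉A

  linked : ∀ c {b w} → b ∉ A → w ∈ A → Link c (inj₁ b) (inj₁ w) →
    Σ (Fin (m G)) λ e → Joins e b w × colour c (inj₂ e) ≡ true
  linked c b∉A w∈A (inj₂ e , col , ib , iw) = e , joins-inc (λ { refl → b∉A w∈A }) ib iw , col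

  module _ {b b'} (b∉A : b ∉ A) (b'∉A : b' ∉ A) where

    -- All neighbours of `b` lie in the clique, whose elements are the positions of the link
    -- comparison. Colour zero transfers adjacency, the others transfer edge colours.
    transfer : vertex-preorder ⊢ inj₁ b ≈ inj₁ b' → ∀ {w e} c → Joins e b w → colour c (inj₂ e) ≡ true →
      Σ (Fin (m G)) λ e' → Joins e' b' w × colour c (inj₂ e') ≡ true
    transfer b≈b' {e = e} c j col = linked c b'∉A w∈A
      (≈⇒link b≈b' c w∈A (inj₂ e , col , joins-incˡ j , joins-incˡ (joins-sym j)))
      where w∈A = nbr∈A b∉A (e , j)

    transfer-adj : vertex-preorder ⊢ inj₁ b ≈ inj₁ b' → ∀ {w} → Adj G b w → Adj G b' w
    transfer-adj b≈b' (e , j) with transfer b≈b' zero j refl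
    ... | e' , j' , _ = e' , j'

    transfer-edgeColour : vertex-preorder ⊢ inj₁ b ≈ inj₁ b' → ∀ c {w} → Adj G b w →
      edgeColour (N b) c b w ≡ true → edgeColour (N b') c b' w ≡ true
    transfer-edgeColour b≈b' c (e , j) col
      with transfer b≈b' (suc c) j (trans (colour-joins c b∉A j) col)
    ... | e' , j' , col' = trans (sym (colour-joins c b'∉A j')) col'

  -- A tie in colour zero gives equal neighbourhoods, hence a common class; ties in the other
  -- colours then give equal tables.
  independent-separates : ∀ {b b'} → b ∉ A → b' ∉ A → vertex-preorder ⊢ inj₁ b ≈ inj₁ b' → b ≡ b'
  independent-separates {b} {b'} b∉A b'∉A b≈b' =
    colours-separate (N b) (b∉A , refl) (b'∉A , sym N≡)
      (λ c → trans (≈⇒colour b≈b' (suc c)) (cong (λ S → vertexColour S c b') (sym N≡)))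
      (λ c {w} w∈ → trans (edges c w∈) (cong (λ S → edgeColour S c b' w) (sym N≡)))
    where
    b'≈b = ≈-sym b≈b'
    N≡ : N b ≡ N b'
    N≡ = tabulate-cong λ w → does-⇔
      (mk⇔ (transfer-adj b∉A b'∉A b≈b') (transfer-adj b'∉A b∉A b'≈b)) (adj? b w) (adj? b' w)
    edges : ∀ c {w} → w ∈ N b → edgeColour (N b) c b w ≡ edgeColour (N b') c b' w
    edges c w∈ = let a = comprehension⁻ (adj? b) w∈ in ≡-from-true
      (transfer-edgeColour b∉A b'∉A b≈b' c a)
      (transfer-edgeColour b'∉A b∉A b'≈b c (transfer-adj b∉A b'∉A b≈b' a))

  vertices-separate : ∀ {u v} → vertex-preorder ⊢ inj₁ u ≈ inj₁ v → u ≡ v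
  vertices-separate {u} {v} u≈v with u ∈? A | v ∈? A
  ... | yes u∈A | _       = inj₁-injective (nested-separates u∈A (≈⇒nested u≈v))
  ... | no _    | yes v∈A = sym (inj₁-injective (nested-separates v∈A (≈-sym (≈⇒nested u≈v))))
  ... | no u∉A  | no v∉A  = independent-separates u∉A v∉A u≈v

  vertex-antisym : ∀ {x y} → ¬ colour zero x ≡ true → ¬ colour zero y ≡ true →
    vertex-preorder ⊢ x ≈ y → x ≡ y
  vertex-antisym {inj₁ u} {inj₁ v} _ _ x≈y = cong inj₁ (vertices-separate x≈y)
  vertex-antisym {inj₂ e} ¬e _ _           = contradiction refl ¬e
  vertex-antisym {inj₁ u} {inj₂ e} _ ¬e _  = contradiction refl ¬e

  module EndsLex = Lex
    {δ = λ i → neg (mem i (colourSet zero))} {ψ = vertexOrder (suc s)} {β = λ i j → inc j i}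
    (λ x → ¬ colour zero x ≡ true) (λ x → ¬? (colour zero x Bool.≟ true)) (λ ρ i → (⇔-id _))
    vertex-preorder vertex-antisym
    (λ x v → Inc G v x) (λ x v → inc? v x) (λ ρ i j → (⇔-id _))

  abstract
    ends-preorder : Preorder
      (lex (λ i → neg (mem i (colourSet zero))) (vertexOrder (suc s)) (λ i j → inc j i))
    ends-preorder = EndsLex.lex-preorder

    ends-kernel : ∀ {x y} → ends-preorder ⊢ x ≈ y → ∀ v → Inc G (inj₁ v) x → Inc G (inj₁ v) y
    ends-kernel x≈y v = proj₁ (EndsLex.lex-kernel x≈y {inj₁ v} λ ())

    full-preorder : Preorder (orderFormula s)
    full-preorder = then-preorder vertex-preorder ends-preorder

    full-kernel : ∀ {x y} → full-preorder ⊢ x ≈ y → vertex-preorder ⊢ x ≈ y × ends-preorder ⊢ x ≈ y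
    full-kernel = then-kernel vertex-preorder ends-preorder

  -- One inclusion suffices: `e` has two distinct ends, and no other edge joins them.
  same-ends : ∀ {e e'} → (∀ v → Inc G (inj₁ v) (inj₂ e) → Inc G (inj₁ v) (inj₂ e')) → e ≡ e'
  same-ends {e} sub = joins-unique (ends-joins e)
    (joins-inc (noLoop G e) (sub _ (inj₁ refl)) (sub _ (inj₂ refl)))

  full-antisym : ∀ {x y} → full-preorder ⊢ x ≈ y → x ≡ y
  full-antisym = separate ∘ full-kernel
    where
    separate : ∀ {x y} → vertex-preorder ⊢ x ≈ y × ends-preorder ⊢ x ≈ y → x ≡ y
    separate {inj₁ u} {inj₁ v}  (p , _) = cong inj₁ (vertices-separate p)
    separate {inj₁ u} {inj₂ e}  (p , _) = contradiction (≈⇒colour p zero) λ ()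
    separate {inj₂ e} {inj₁ v}  (p , _) = contradiction (≈⇒colour p zero) λ ()
    separate {inj₂ e} {inj₂ e'} (_ , q) = cong inj₂ (same-ends (ends-kernel q))

  Sat-order : U G → U G → Set
  Sat-order a b = Sat G (orderFormula s zero (suc zero)) (pair a b) params

  ordered : IsTotalOrder _≡_ Sat-order
  ordered = record
    { isPartialOrder = record
      { isPreorder = record
        { isEquivalence = isEquivalence
        ; reflexive     = λ { {x} refl → from (def x x) (≼-refl full-preorder) }
        ; trans         = λ {x} {y} {z} p q →
            from (def x z) (≼-trans full-preorder (to (def x y) p) (to (def y z) q))
        }
      ; antisym = λ {x} {y} p q → full-antisym (to (def x y) p , to (def y x) q)
      }
    ; total = λ x y → [ inj₁ ∘ from (def x y) , inj₂ ∘ from (def y x) ]′ (total full-preorder x y)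
    }
    where
    def : ∀ x y → Sat-order x y ⇔ _≼_ full-preorder x y
    def x y = defines full-preorder (pair x y) zero (suc zero)

theorem4p32 : (C : Graph → Set) → (∀ G → C G → IsSplit G) →
    MSO2Orderable C ⇔ Σ ℕ (λ s → ClassHasSEP (λ k → 2 ^ (s * suc k)) C)
theorem4p32 C split = mk⇔ orderable⇒sep sep⇒orderable
  where
  orderable⇒sep : MSO2Orderable C → Σ ℕ (λ s → ClassHasSEP (λ k → 2 ^ (s * suc k)) C)
  -- One table row for adjacency and one for each of the `l` parameters. The representative `r zero`
  -- witnesses that the graph is nonempty.
  orderable⇒sep (l , φ , order) = suc l , λ G CG k S small r →
    let P , isOrder = order G CG (inj₁ (r zero))
    in Forward.sep G φ P isOrder (split G CG) k S small r

  sep⇒orderable : Σ ℕ (λ s → ClassHasSEP (λ k → 2 ^ (s * suc k)) C) → MSO2Orderable C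
  -- The parameters are the clique, the threshold set, the set of all edges, and `s` colours, each
  -- colouring vertices and edges at once.
  sep⇒orderable (s , sep) = suc (suc (suc s)) , orderFormula s zero (suc zero) , λ G CG _ →
    let open Backward G (split G CG) s (sep G CG) in params , ordered
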